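{- For every integer $r\ge 2$ there exists $c=c(r)>0$ such that for infinitely many integers $n$, there exists an $n$-vertex $2$-connected graph $G$ with $s_r(G)\ge c\sqrt{n}$ and $\mathcal{D}_r(G,\mathcal{T}_n)\le 1$.
   Context: Graphs are finite and simple; "$k$-connected" means $k$-vertex-connected. Spanning-tree discrepancy: for a connected $n$-vertex graph $G$, an $r$-colouring $f:E(G)\to[r]$ of its edges, and a spanning tree $T$ of $G$ (which has $n-1$ edges), put $D_f(T) := r\cdot\left(\max_{1\le i\le r}|f^{ -1}(i)\cap E(T)| - \frac{n-1}{r}\right)$. The $r$-colour spanning-tree discrepancy of $G$ is $\mathcal{D}_r(G,\mathcal{T}_n) := \min_{f:E(G)\to[r]}\ \max_{T} D_f(T)$, where the maximum is over all spanning trees $T$ of $G$. Balanced $r$-separation number: $s_r(G)$ is the minimum $s$ for which there is a partition $V(G)=V_1\cup\dots\cup V_r\cup S$ with $|V_1|=\dots=|V_r|$, $|S|=s$, and no edges of $G$ between $V_i$ and $V_j$ for any $1\le i<j\le r$ (the parts may be empty). -}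

module Defs where

open import Data.Fin using (Fin; zero; suc; inject₁; fromℕ; _<_)
open import Data.Fin.Properties using (_≟_)
open import Data.Fin.Subset using (Subset; _∈_; _∉_; _∩_; ⊤; ∣_∣)
open import Data.Integer using (+_)
open import Data.Maybe using (Maybe; just; nothing)
import Data.Maybe.Properties as Maybe
open import Data.Nat as ℕ using (ℕ; NonZero; _∸_; _⊔_)
open import Data.Product using (∃-syntax; _×_; _,_; proj₁; proj₂)
open import Data.Rational as ℚ using (ℚ; _/_)
open import Data.Sum using (_⊎_)
open import Data.Vec using (tabulate)
import Data.Vec.Functional as Vector
open import Function using (flip)
open import Function.Definitions using (Injective)
open import Level using (0ℓ)
open import Relation.Binary using (Rel)
open import Relation.Binary.Construct.Closure.ReflexiveTransitive using (Star)
open import Relation.Binary.PropositionalEquality using (_≡_; _≢_)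
open import Relation.Nullary using (¬_; does)
open import Relation.Unary using (Pred; Decidable)

toℚ : ℕ → ℚ
toℚ k = + k / 1

-- For c ≥ 0 this is the inequality s ≥ c · √ n, squared to stay within ℚ.
_≥_√_ : ℕ → ℚ → ℕ → Set
s ≥ c √ n = c ℚ.* c ℚ.* toℚ n ℚ.≤ toℚ s ℚ.* toℚ s

IsMinimum IsMaximum : ∀ {A : Set} → Rel A 0ℓ → Pred A 0ℓ → Pred A 0ℓ
IsMinimum _≤_ P a = P a × (∀ {b} → P b → a ≤ b)
IsMaximum _≤_     = IsMinimum (flip _≤_)

subset : ∀ {n} {P : Pred (Fin n) 0ℓ} → Decidable P → Subset n
subset P? = tabulate (λ x → does (P? x))

-- A simple graph on the vertex set Fin n, with its edge set enumerated as
-- Fin size.  An edge {u , v} is stored once, as the pair with u < v, which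
-- excludes loops; injectivity of ends excludes parallel edges.
record Graph (n : ℕ) : Set where
  field
    size           : ℕ
    ends           : Fin size → Fin n × Fin n
    ends-ordered   : ∀ e → proj₁ (ends e) < proj₂ (ends e)
    ends-injective : Injective _≡_ _≡_ ends

  Adjacent[_] : Subset size → Rel (Fin n) 0ℓ
  Adjacent[ F ] u v = ∃[ e ] e ∈ F × (ends e ≡ (u , v) ⊎ ends e ≡ (v , u))

  Adjacent : Rel (Fin n) 0ℓ
  Adjacent = Adjacent[ ⊤ ]

record Cycle {n : ℕ} (_~_ : Rel (Fin n) 0ℓ) : Set where
  field
    k         : ℕ
    vertex    : Fin (3 ℕ.+ k) → Fin n
    injective : Injective _≡_ _≡_ vertex
    step      : ∀ i → vertex (inject₁ i) ~ vertex (suc i)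
    close     : vertex (fromℕ (2 ℕ.+ k)) ~ vertex zero

module _ {n : ℕ} (G : Graph n) where
  open Graph G

  AdjacentAvoiding : Subset n → Rel (Fin n) 0ℓ
  AdjacentAvoiding X u v = u ∉ X × v ∉ X × Adjacent u v

  VertexConnected : ℕ → Set
  VertexConnected k = k ℕ.< n ×
    (∀ X → ∣ X ∣ ℕ.< k → ∀ {u v} → u ∉ X → v ∉ X → Star (AdjacentAvoiding X) u v)

  -- A spanning tree is identified with its edge set.
  record IsSpanningTree (T : Subset size) : Set where
    field
      connected : ∀ u v → Star Adjacent[ T ] u v
      acyclic   : ¬ Cycle Adjacent[ T ]

  Colouring : ℕ → Set
  Colouring r = Fin size → Fin r

  colourClass : ∀ {r} → Colouring r → Fin r → Subset size
  colourClass f i = subset (λ e → f e ≟ i)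

  maxColour : ∀ {r} → Colouring r → Subset size → ℕ
  maxColour f T = Vector.foldr _⊔_ 0 (λ i → ∣ colourClass f i ∩ T ∣)

  treeDiscrepancy : ∀ {r} .{{_ : NonZero r}} → Colouring r → Subset size → ℚ
  treeDiscrepancy {r} f T = toℚ r ℚ.* (toℚ (maxColour f T) ℚ.- + (n ∸ 1) / r)

  IsColouringDiscrepancy : ∀ {r} .{{_ : NonZero r}} → Colouring r → ℚ → Set
  IsColouringDiscrepancy f =
    IsMaximum ℚ._≤_ (λ d → ∃[ T ] IsSpanningTree T × d ≡ treeDiscrepancy f T)

  IsSpanningTreeDiscrepancy : (r : ℕ) .{{_ : NonZero r}} → ℚ → Set
  IsSpanningTreeDiscrepancy r =
    IsMinimum ℚ._≤_ (λ d → ∃[ f ] IsColouringDiscrepancy {r} f d)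

  -- The partition is given by its labelling: V i is the fibre over just i
  -- and S is the fibre over nothing.
  record BalancedSeparation (r : ℕ) : Set where
    field
      part : Fin n → Maybe (Fin r)

    fibre : Maybe (Fin r) → Subset n
    fibre x = subset (λ v → Maybe.≡-dec _≟_ (part v) x)

    V : Fin r → Subset n
    V i = fibre (just i)

    S : Subset n
    S = fibre nothing

    field
      balanced  : ∀ i j → ∣ V i ∣ ≡ ∣ V j ∣
      separated : ∀ {i j} → i ≢ j → ∀ {u v} → u ∈ V i → v ∈ V j → ¬ Adjacent u v

  IsSeparationNumber : ℕ → ℕ → Set
  IsSeparationNumber r =
    IsMinimum ℕ._≤_ (λ s → ∃[ P ] ∣ BalancedSeparation.S {r} P ∣ ≡ s)

{-# OPTIONS --safe #-}

-- Write q = 1 + K for a multiple q of r, and T = (r - 1) K, so that T = r u + 1.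
-- The graph is a Hamiltonian cycle on n = T q vertices together with all edges
-- inside each of the T consecutive blocks of q vertices.
--
-- Separation: a clique block meets at most one part V i, so some V i meets at most
-- u blocks.  All parts then have at most u q vertices, which leaves at least q for S.
--
-- Discrepancy: the forest edges inside a block inject into its non-first vertices,
-- and the edges between blocks into the first vertices.  It is therefore enough to
-- colour the vertices evenly, constantly on the non-first vertices of each block.
-- Colouring block b by b mod r leaves colour 0 one block, that is K vertices,
-- ahead, and the (r - 1) K first vertices fill up the other r - 1 colours.
module Submission where

open import Defs
open import Data.Fin as Fin using (Fin; zero; suc; toℕ; fromℕ; inject₁; inject≤; combine)
open import Data.Fin.Properties as Fin using (_≟_; any?; all?; toℕ-injective; toℕ-inject≤; combine-injective;
  injective⇒≤)
open import Data.Fin.Subset using (Subset; _∈_; _∉_; _∩_; ∁; ⊤; ∣_∣; inside; outside)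
open import Data.Fin.Subset.Properties using (∣∁p∣≡n∸∣p∣; x∈∁p⇒x∉p; _∈?_; ∈⊤;
  x∈p⇒∣p-x∣<∣p∣; x∈p∧x≢y⇒x∈p-y; x∈p∩q⁺; x∈p∩q⁻)
open import Data.Integer as ℤ using (+_; +≤+)
import Data.Integer.Properties as ℤ
open import Data.List using (List; []; _∷_; filter; allFin; lookup; length; cartesianProduct)
open import Data.List.Membership.Propositional using () renaming (_∈_ to _∈ˡ_; _∉_ to _∉ˡ_)
open import Data.List.Membership.Propositional.Properties using (∈-lookup; ∈-filter⁺; ∈-filter⁻;
  ∈-allFin; ∈-cartesianProduct⁺)
open import Data.List.Relation.Unary.All as All using (All; []; _∷_)
open import Data.List.Relation.Unary.All.Properties using (all-filter)
open import Data.List.Relation.Unary.AllPairs using ([]; _∷_)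
open import Data.List.Relation.Unary.Any using (here; there; index)
open import Data.List.Relation.Unary.Any.Properties using (lookup-index)
open import Data.List.Relation.Unary.Unique.Propositional using (Unique)
import Data.List.Relation.Unary.Unique.Propositional.Properties as Unique
open import Data.Maybe using (Maybe; just; nothing)
import Data.Maybe.Properties as Maybe
open import Data.Nat as ℕ using (ℕ; NonZero; zero; suc; _∸_; _⊔_; s≤s; z≤n)
import Data.Nat.Properties as ℕ
open import Data.Nat.Tactic.RingSolver using (solve-∀)
open import Data.Product using (∃-syntax; _×_; _,_; proj₁; proj₂; uncurry)
open import Data.Product.Properties using (≡-dec)
open import Data.Rational as ℚ using (ℚ; 0ℚ; 1ℚ; _/_; toℚᵘ)
import Data.Rational.Properties as ℚ
open import Data.Rational.Unnormalised as ℚᵘ using (mkℚᵘ; *≡*; *≤*; _≃_)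
import Data.Rational.Unnormalised.Properties as ℚᵘ
open import Data.Sum as Sum using (_⊎_; inj₁; inj₂)
open import Data.Vec using ([]; _∷_; here; there)
import Data.Vec.Functional as Vector
open import Data.Vec.Properties using ([]=⇒lookup; lookup⇒[]=; lookup∘tabulate; tabulate-cong)
open import Function using (_∘_)
open import Function.Definitions using (Injective)
open import Level using (0ℓ)
open import Relation.Binary using (Rel; _⇒_; Symmetric; tri<; tri≈; tri>)
open import Relation.Binary.Construct.Closure.ReflexiveTransitive as Star using (Star; ε; _◅_; _◅◅_)
open import Relation.Binary.PropositionalEquality
open import Relation.Nullary using (¬_; Dec; yes; no; does; contradiction; ¬?; _×-dec_; _⊎-dec_; _→-dec_)
open import Relation.Nullary.Decidable using (dec-true; map′)
open import Relation.Unary using (Pred; Decidable)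

private variable
  m n : ℕ

-- Counting with subsets of `Fin n`.

module _ {P : Pred (Fin n) 0ℓ} (P? : Decidable P) where

  ∈-subset⁺ : ∀ {x} → P x → x ∈ subset P?
  ∈-subset⁺ {x} px = lookup⇒[]= x _ (trans (lookup∘tabulate _ x) (dec-true (P? x) px))

  ∈-subset⁻ : ∀ {x} → x ∈ subset P? → P x
  ∈-subset⁻ {x} x∈p with P? x | trans (sym (lookup∘tabulate (λ y → does (P? y)) x)) ([]=⇒lookup x∈p)
  ... | yes px | _ = px

enumerate : (p : Subset n) → Fin ∣ p ∣ → Fin n
enumerate (inside  ∷ p) zero    = zero
enumerate (inside  ∷ p) (suc i) = suc (enumerate p i)
enumerate (outside ∷ p) i       = suc (enumerate p i)

enumerate-∈ : (p : Subset n) (i : Fin ∣ p ∣) → enumerate p i ∈ p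
enumerate-∈ (inside  ∷ p) zero    = here
enumerate-∈ (inside  ∷ p) (suc i) = there (enumerate-∈ p i)
enumerate-∈ (outside ∷ p) i       = there (enumerate-∈ p i)

enumerate-injective : (p : Subset n) → Injective _≡_ _≡_ (enumerate p)
enumerate-injective (inside  ∷ p) {zero}  {zero}  _  = refl
enumerate-injective (inside  ∷ p) {suc i} {suc j} eq =
  cong suc (enumerate-injective p (Fin.suc-injective eq))
enumerate-injective (outside ∷ p) eq = enumerate-injective p (Fin.suc-injective eq)

rank : {p : Subset n} {x : Fin n} → x ∈ p → Fin ∣ p ∣
rank {p = inside  ∷ p} here        = zero
rank {p = inside  ∷ p} (there x∈p) = suc (rank x∈p)
rank {p = outside ∷ p} (there x∈p) = rank x∈p

rank-injective : {p : Subset n} {x y : Fin n} (x∈p : x ∈ p) (y∈p : y ∈ p) →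
  rank x∈p ≡ rank y∈p → x ≡ y
rank-injective {p = inside  ∷ p} here        here        _  = refl
rank-injective {p = inside  ∷ p} (there x∈p) (there y∈p) eq =
  cong suc (rank-injective x∈p y∈p (Fin.suc-injective eq))
rank-injective {p = outside ∷ p} (there x∈p) (there y∈p) eq =
  cong suc (rank-injective x∈p y∈p eq)

-- The map receives the membership proof, so it has to be defined and injective on `p` only.
∣p∣≤ : (p : Subset n) (f : ∀ {x} → x ∈ p → Fin m) →
  (∀ {x y} (x∈p : x ∈ p) (y∈p : y ∈ p) → f x∈p ≡ f y∈p → x ≡ y) → ∣ p ∣ ℕ.≤ m
∣p∣≤ p f f-injective = injective⇒≤ {f = λ i → f (enumerate-∈ p i)}
  λ eq → enumerate-injective p (f-injective (enumerate-∈ p _) (enumerate-∈ p _) eq)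

module _ {r k : ℕ} (p : Fin r → Subset n) where

  -- Each point is sent to its colour and its rank in that class, one of `r * k` pairs.
  covering⇒≤ : ∀ {N} → (∀ i → ∣ p i ∣ ℕ.≤ k) → (f : Fin N → Fin n) → Injective _≡_ _≡_ f →
    (colour : Fin N → Fin r) → (∀ x → f x ∈ p (colour x)) → N ℕ.≤ r ℕ.* k
  covering⇒≤ {N} ∣p∣≤k f f-injective colour f∈p = injective⇒≤ {f = slot} slot-injective
    where
    slot : Fin N → Fin (r ℕ.* k)
    slot x = combine (colour x) (inject≤ (rank (f∈p x)) (∣p∣≤k (colour x)))

    same : ∀ {i j x y} (x∈ : x ∈ p i) (y∈ : y ∈ p j) → i ≡ j →
      toℕ (rank x∈) ≡ toℕ (rank y∈) → x ≡ y
    same x∈ y∈ refl eq = rank-injective x∈ y∈ (toℕ-injective eq)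

    slot-injective : Injective _≡_ _≡_ slot
    slot-injective {x} {y} eq with combine-injective (colour x) _ (colour y) _ eq
    ... | eq₁ , eq₂ = f-injective (same (f∈p x) (f∈p y) eq₁
      (trans (sym (toℕ-inject≤ _ _)) (trans (cong toℕ eq₂) (toℕ-inject≤ _ _))))

  -- The first `k` elements of every `p i` are together `r * k` distinct points.
  disjoint⇒≤ : (∀ i → k ℕ.≤ ∣ p i ∣) → (∀ {i j x} → x ∈ p i → x ∈ p j → i ≡ j) →
    r ℕ.* k ℕ.≤ n
  disjoint⇒≤ k≤∣p∣ disjoint = injective⇒≤ {f = pick ∘ Fin.remQuot k} λ {x} {y} eq →
    trans (sym (Fin.combine-remQuot {r} k x))
      (trans (pick-injective (Fin.remQuot k x) (Fin.remQuot k y) eq) (Fin.combine-remQuot {r} k y))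
    where
    pick : Fin r × Fin k → Fin n
    pick (i , j) = enumerate (p i) (inject≤ j (k≤∣p∣ i))

    pick-injective : ∀ x y → pick x ≡ pick y →
      combine (proj₁ x) (proj₂ x) ≡ combine (proj₁ y) (proj₂ y)
    pick-injective (i , j) (i′ , j′) eq
      with refl ← disjoint (enumerate-∈ (p i) _) (subst (_∈ p i′) (sym eq) (enumerate-∈ (p i′) _))
      = cong (combine i) (Fin.inject≤-injective _ _ _ _ (enumerate-injective (p i) eq))

-- Simple paths and cycles.

record SimplePath (_~_ : Rel (Fin n) 0ℓ) (u v : Fin n) : Set where
  field
    steps     : ℕ
    vertex    : Fin (suc steps) → Fin n
    injective : Injective _≡_ _≡_ vertex
    step      : ∀ i → vertex (inject₁ i) ~ vertex (suc i)
    start     : vertex zero ≡ u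
    finish    : vertex (fromℕ steps) ≡ v

module _ {_~_ : Rel (Fin n) 0ℓ} where

  open SimplePath

  suffix : ∀ {u v} k (p : Fin (suc k) → Fin n) → Injective _≡_ _≡_ p →
    (∀ i → p (inject₁ i) ~ p (suc i)) → p (fromℕ k) ≡ v →
    ∀ i → p i ≡ u → SimplePath _~_ u v
  suffix k p p-injective p-step p-finish zero eq = record
    { steps = k ; vertex = p ; injective = p-injective ; step = p-step
    ; start = eq ; finish = p-finish }
  suffix (suc k) p p-injective p-step p-finish (suc i) eq =
    suffix k (p ∘ suc) (Fin.suc-injective ∘ p-injective) (p-step ∘ suc) p-finish i eq

  -- Loop erasure: if `w` already lies on the path, the part before it is dropped.
  prepend : ∀ {w u v} → w ~ u → SimplePath _~_ u v → SimplePath _~_ w v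
  prepend {w} w~u P with any? (λ i → vertex P i ≟ w)
  ... | yes (i , eq) = suffix _ (vertex P) (injective P) (step P) (finish P) i eq
  ... | no w∉P = record
    { steps     = suc (steps P)
    ; vertex    = λ { zero → w ; (suc i) → vertex P i }
    ; injective = λ { {zero} {zero} _ → refl
                    ; {zero} {suc j} eq → contradiction (j , sym eq) w∉P
                    ; {suc i} {zero} eq → contradiction (i , eq) w∉P
                    ; {suc i} {suc j} eq → cong suc (injective P eq) }
    ; step      = λ { zero → subst (w ~_) (sym (start P)) w~u ; (suc i) → step P i }
    ; start     = refl
    ; finish    = finish P
    }

  simplePath : ∀ {u v} → Star _~_ u v → SimplePath _~_ u v
  simplePath {u} ε = record
    { steps = 0 ; vertex = λ _ → u ; injective = λ { {zero} {zero} _ → refl }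
    ; step = λ () ; start = refl ; finish = refl }
  simplePath (u~w ◅ p) = prepend u~w (simplePath p)

Cycle-map : {R S : Rel (Fin n) 0ℓ} → R ⇒ S → Cycle R → Cycle S
Cycle-map R⇒S C = record { Cycle C ; step = R⇒S ∘ Cycle.step C ; close = R⇒S (Cycle.close C) }

-- Forests: an injection from edges to vertices by union-find.

module Forests (G : Graph n) where
  open Graph G

  Joins : Fin size → Rel (Fin n) 0ℓ
  Joins e u v = ends e ≡ (u , v) ⊎ ends e ≡ (v , u)

  Joined[_] : List (Fin size) → Rel (Fin n) 0ℓ
  Joined[ es ] u v = ∃[ e ] e ∈ˡ es × Joins e u v

  ordered : ∀ {e u v} → ends e ≡ (u , v) → u Fin.< v
  ordered {e} eq = subst₂ Fin._<_ (cong proj₁ eq) (cong proj₂ eq) (ends-ordered e)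

  -- Two edges cannot store the same pair in opposite orders, because `ends` lists the smaller
  -- vertex first.
  Joins-injective : ∀ {e e′ u v} → Joins e u v → Joins e′ u v → e ≡ e′
  Joins-injective (inj₁ p) (inj₁ q) = ends-injective (trans p (sym q))
  Joins-injective (inj₂ p) (inj₂ q) = ends-injective (trans p (sym q))
  Joins-injective (inj₁ p) (inj₂ q) = contradiction (ordered p) (Fin.<-asym (ordered q))
  Joins-injective (inj₂ p) (inj₁ q) = contradiction (ordered p) (Fin.<-asym (ordered q))

  Joins-irrefl : ∀ {e u} → ¬ Joins e u u
  Joins-irrefl (inj₁ p) = Fin.<-irrefl refl (ordered p)
  Joins-irrefl (inj₂ p) = Fin.<-irrefl refl (ordered p)

  Joined-sym : ∀ {es} → Symmetric Joined[ es ]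
  Joined-sym (e , e∈es , joins) = e , e∈es , Sum.swap joins

  weaken : ∀ {e es} → Joined[ es ] ⇒ Joined[ e ∷ es ]
  weaken (e , e∈es , joins) = e , there e∈es , joins

  -- After loop erasure, a path without steps would make `e` a loop, and a path with one step would
  -- use an edge parallel to `e`, hence `e` itself. A longer path has at least three vertices and
  -- closes up to a cycle.
  close-path : ∀ {e es u v} → e ∉ˡ es → Joins e u v → Star Joined[ es ] u v →
    Cycle Joined[ e ∷ es ]
  close-path {e} {es} e∉es joins path with simplePath path
  ... | record { steps = 0 ; start = refl ; finish = refl } =
    contradiction joins Joins-irrefl
  ... | record { steps = 1 ; step = step ; start = refl ; finish = refl } with step zero
  ...   | e′ , e′∈es , joins′ =
    contradiction (subst (_∈ˡ es) (Joins-injective joins′ joins) e′∈es) e∉es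
  close-path {e} e∉es joins path
      | record { steps = suc (suc k) ; vertex = vertex ; injective = injective
               ; step = step ; start = refl ; finish = refl } = record
    { k = k ; vertex = vertex ; injective = injective ; step = weaken ∘ step
    ; close = e , here refl , Sum.swap joins }

  module _ (ρ : Fin n → Fin n) where

    -- Every edge of es merged two classes, and child is the root that it made redundant.
    record UnionFind (es : List (Fin size)) : Set where
      field
        root            : Fin n → Fin n
        reach           : ∀ v → Star Joined[ es ] v (root v)
        root-idempotent : ∀ v → root (root v) ≡ root v
        ρ-root          : ∀ v → ρ (root v) ≡ ρ v
        child           : Fin size → Fin n
        child-dead      : ∀ {e} → e ∈ˡ es → root (child e) ≢ child e
        child-moved     : ∀ {e} → e ∈ˡ es → ρ (child e) ≢ child e
        ρ-child         : ∀ {e} → e ∈ˡ es → ρ (child e) ≡ ρ (proj₁ (ends e))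
        child-injective : ∀ {e e′} → e ∈ˡ es → e′ ∈ˡ es → child e ≡ child e′ → e ≡ e′

    redirect : Fin n → Fin n → Fin n → Fin n
    redirect a b w with w ≟ a
    ... | yes _ = b
    ... | no  _ = w

    redirect-≢ : ∀ a b {w} → w ≢ a → redirect a b w ≡ w
    redirect-≢ a b {w} w≢a with w ≟ a
    ... | yes w≡a = contradiction w≡a w≢a
    ... | no  _   = refl

    -- The class of `x` is redirected to the root of `y`, and the old root of `x` becomes the child
    -- of `e`. Stating this for `Joins e x y` allows either end of `e` to lose its root.
    merge : ∀ {e es x y} (U : UnionFind es) → let open UnionFind U in
      e ∉ˡ es → Joins e x y → ρ x ≡ ρ y → ρ x ≡ ρ (proj₁ (ends e)) →
      root x ≢ root y → ρ (root x) ≢ root x → UnionFind (e ∷ es)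
    merge {e} {es} {x} {y} U e∉es joins ρx≡ρy ρx≡ρe a≢b a-moved = record
      { root            = root′
      ; reach           = reach′
      ; root-idempotent = idem
      ; ρ-root          = ρ-root′
      ; child           = child′
      ; child-dead      = λ { (here refl) eq → root′≢a _ (trans eq child-new)
                            ; (there e∈) eq → old-dead e∈ (trans eq (child-old e∈)) }
      ; child-moved     = λ { (here refl) → subst (λ c → ρ c ≢ c) (sym child-new) a-moved
                            ; (there e∈) → subst (λ c → ρ c ≢ c) (sym (child-old e∈)) (child-moved e∈) }
      ; ρ-child         = λ { (here refl) → trans (cong ρ child-new) (trans (ρ-root x) ρx≡ρe)
                            ; (there e∈) → trans (cong ρ (child-old e∈)) (ρ-child e∈) }
      ; child-injective = inj′
      }
      where
      open UnionFind U
      a b : Fin n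
      a = root x
      b = root y

      root′ : Fin n → Fin n
      root′ w = redirect a b (root w)

      child′ : Fin size → Fin n
      child′ e′ with e′ ≟ e
      ... | yes _ = a
      ... | no  _ = child e′

      child-new : child′ e ≡ a
      child-new with e ≟ e
      ... | yes _   = refl
      ... | no  e≢e = contradiction refl e≢e

      child-old : ∀ {e′} → e′ ∈ˡ es → child′ e′ ≡ child e′
      child-old {e′} e′∈es with e′ ≟ e
      ... | yes refl = contradiction e′∈es e∉es
      ... | no  _    = refl

      root′≢a : ∀ w → root′ w ≢ a
      root′≢a w eq with root w ≟ a
      ... | yes _  = a≢b (sym eq)
      ... | no  w≢a = w≢a eq

      -- Earlier children are dead, while `a` is still a root before the merge; so the new child is
      -- fresh.
      old-alive : ∀ {e′} → e′ ∈ˡ es → child e′ ≢ a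
      old-alive e′∈es eq = child-dead e′∈es
        (trans (cong root eq) (trans (root-idempotent x) (sym eq)))

      -- The merge cannot revive a child: a redirected one would have to equal `b`, which is a root.
      old-dead : ∀ {e′} → e′ ∈ˡ es → root′ (child′ e′) ≢ child e′
      old-dead {e′} e′∈es eq with root (child′ e′) ≟ a | cong root (child-old e′∈es)
      ... | no _  | eq′ = child-dead e′∈es (trans (sym eq′) eq)
      ... | yes _ | _   = child-dead e′∈es
        (trans (cong root (sym eq)) (trans (root-idempotent y) eq))

      idem : ∀ w → root′ (root′ w) ≡ root′ w
      idem w with root w ≟ a
      ... | yes _ rewrite root-idempotent y = redirect-≢ a b (a≢b ∘ sym)
      ... | no w≢a rewrite root-idempotent w = redirect-≢ a b w≢a

      lift : ∀ {u v} → Star Joined[ es ] u v → Star Joined[ e ∷ es ] u v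
      lift = Star.map weaken

      reach′ : ∀ w → Star Joined[ e ∷ es ] w (root′ w)
      reach′ w with root w ≟ a
      ... | no _    = lift (reach w)
      -- Here `w` and `x` share the root `a`: the path runs through `a` to `x`, across `e`, and on
      -- to `b`.
      ... | yes w≡a = subst (Star _ w) w≡a (lift (reach w)) ◅◅
        Star.reverse Joined-sym (lift (reach x)) ◅◅ (e , here refl , joins) ◅ lift (reach y)

      ρ-root′ : ∀ w → ρ (root′ w) ≡ ρ w
      ρ-root′ w with root w ≟ a
      ... | no _    = ρ-root w
      ... | yes w≡a = trans (ρ-root y) (trans (sym ρx≡ρy)
        (trans (sym (ρ-root x)) (trans (cong ρ (sym w≡a)) (ρ-root w))))

      inj′ : ∀ {e₁ e₂} → e₁ ∈ˡ e ∷ es → e₂ ∈ˡ e ∷ es → child′ e₁ ≡ child′ e₂ → e₁ ≡ e₂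
      inj′ (here refl) (here refl) _ = refl
      inj′ (here refl) (there e₂∈) eq =
        contradiction (trans (sym (child-old e₂∈)) (trans (sym eq) child-new)) (old-alive e₂∈)
      inj′ (there e₁∈) (here refl) eq =
        contradiction (trans (sym (child-old e₁∈)) (trans eq child-new)) (old-alive e₁∈)
      inj′ (there e₁∈) (there e₂∈) eq =
        child-injective e₁∈ e₂∈ (trans (sym (child-old e₁∈)) (trans eq (child-old e₂∈)))

    -- Edges are added one at a time. The ends of a new edge have different roots, since otherwise
    -- their paths to the common root would close up with the edge to a cycle. The outcome injects
    -- the forest edges into the vertices that `ρ` moves, staying within the fibres of `ρ`.
    unionFind : ∀ {es} → Unique es → ¬ Cycle Joined[ es ] →
      All (λ e → ρ (proj₁ (ends e)) ≡ ρ (proj₂ (ends e))) es → UnionFind es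
    unionFind {[]} _ _ _ = record
      { root = λ v → v ; reach = λ _ → ε ; root-idempotent = λ _ → refl ; ρ-root = λ _ → refl
      -- `child` is constrained on members of the list only, so this is an arbitrary default.
      ; child = proj₁ ∘ ends ; child-dead = λ () ; child-moved = λ ()
      ; ρ-child = λ () ; child-injective = λ () }
    unionFind {e ∷ es} (e# ∷ unique) acyclic (ρx≡ρy ∷ ρ-const)
      with U ← unionFind unique (acyclic ∘ Cycle-map weaken) ρ-const = go
      where
      open UnionFind U
      x y : Fin n
      x = proj₁ (ends e)
      y = proj₂ (ends e)

      e∉es : e ∉ˡ es
      e∉es e∈es = All.lookup e# e∈es refl

      roots-differ : root x ≢ root y
      roots-differ eq = acyclic (close-path e∉es (inj₁ refl)
        (reach x ◅◅ subst (λ z → Star _ z y) (sym eq) (Star.reverse Joined-sym (reach y))))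

      -- ρ agrees on the two roots, so it fixes at most one of them; the other can be killed.
      go : UnionFind (e ∷ es)
      go with ρ (root x) ≟ root x
      ... | no x-moved = merge U e∉es (inj₁ refl) ρx≡ρy refl roots-differ x-moved
      ... | yes x-fixed = merge U e∉es (inj₂ refl) (sym ρx≡ρy) (sym ρx≡ρy) (roots-differ ∘ sym)
        λ y-fixed → roots-differ (trans (sym x-fixed) (trans (ρ-root x)
          (trans ρx≡ρy (trans (sym (ρ-root y)) y-fixed))))

-- Graphs from a decidable relation.

Unique⇒lookup-injective : {A : Set} {xs : List A} → Unique xs → Injective _≡_ _≡_ (lookup xs)
Unique⇒lookup-injective (x# ∷ _)      {zero}  {zero}  _  = refl
Unique⇒lookup-injective (x# ∷ _)      {zero}  {suc j} eq = contradiction eq (All.lookup x# (∈-lookup j))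
Unique⇒lookup-injective (x# ∷ _)      {suc i} {zero}  eq = contradiction (sym eq) (All.lookup x# (∈-lookup i))
Unique⇒lookup-injective (_  ∷ unique) {suc i} {suc j} eq = cong suc (Unique⇒lookup-injective unique eq)

module FromRelation {P : Pred (Fin n × Fin n) 0ℓ} (P? : Decidable P)
  (P⇒< : ∀ {u v} → P (u , v) → u Fin.< v) where

  pairs edges : List (Fin n × Fin n)
  pairs = cartesianProduct (allFin n) (allFin n)
  edges = filter P? pairs

  graph : Graph n
  graph = record
    { size           = length edges
    ; ends           = lookup edges
    ; ends-ordered   = λ e → P⇒< (proj₂ (∈-filter⁻ P? {xs = pairs} (∈-lookup {xs = edges} e)))
    ; ends-injective = Unique⇒lookup-injective
        (Unique.filter⁺ P? (Unique.cartesianProduct⁺ (Unique.allFin⁺ n) (Unique.allFin⁺ n)))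
    }
  open Graph graph

  related : ∀ e → P (ends e)
  related e = proj₂ (∈-filter⁻ P? {xs = pairs} (∈-lookup {xs = edges} e))

  edge : ∀ {u v} → P (u , v) → ∃[ e ] ends e ≡ (u , v)
  edge {u} {v} p = index uv∈ , sym (lookup-index uv∈)
    where
    uv∈ : (u , v) ∈ˡ edges
    uv∈ = ∈-filter⁺ P? (∈-cartesianProduct⁺ (∈-allFin u) (∈-allFin v)) p

-- Least witnesses, walks along an interval, monotone sequences and maxima.

least : {P : Pred ℕ 0ℓ} → Decidable P → ∀ k → P k → ∃[ l ] IsMinimum ℕ._≤_ P l
least P? zero    p0 = zero , p0 , λ _ → z≤n
least P? (suc k) pk with P? 0
... | yes p0 = zero , p0 , λ _ → z≤n
... | no ¬p0 with least (P? ∘ suc) k pk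
...   | l , pl , min = suc l , pl , λ { {zero} p0 → contradiction p0 ¬p0 ; {suc j} pj → s≤s (min pj) }

-- Steps are demanded between `u` and `v` only, so that `R` may also require avoiding a vertex
-- outside this interval.
walk : {R : Rel (Fin n) 0ℓ} (u v : Fin n) → u Fin.≤ v →
  (∀ x y → u Fin.≤ x → toℕ y ≡ suc (toℕ x) → y Fin.≤ v → R x y) → Star R u v
walk {R = R} u v u≤v R-step = go (toℕ v ∸ toℕ u) u ℕ.≤-refl u≤v refl
  where
  go : ∀ k x → u Fin.≤ x → x Fin.≤ v → toℕ v ∸ toℕ x ≡ k → Star R x v
  go zero    x u≤x x≤v eq =
    subst (Star R x) (toℕ-injective (ℕ.≤-antisym x≤v (ℕ.m∸n≡0⇒m≤n eq))) ε
  go (suc k) x u≤x x≤v eq = R-step x y u≤x y≡ y≤v ◅ go k y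
    (ℕ.≤-trans u≤x (ℕ.≤-trans (ℕ.n≤1+n _) (ℕ.≤-reflexive (sym y≡)))) y≤v
    (trans (cong (toℕ v ∸_) y≡) (trans (sym (ℕ.pred[m∸n]≡m∸[1+n] (toℕ v) (toℕ x))) (cong ℕ.pred eq)))
    where
    x<v : toℕ x ℕ.< toℕ v
    x<v = ℕ.m∸n≢0⇒n<m λ eq′ → ℕ.0≢1+n (trans (sym eq′) eq)
    y : Fin _
    y = Fin.fromℕ< (ℕ.≤-<-trans x<v (Fin.toℕ<n v))
    y≡ : toℕ y ≡ suc (toℕ x)
    y≡ = Fin.toℕ-fromℕ< _
    y≤v : y Fin.≤ v
    y≤v = ℕ.≤-trans (ℕ.≤-reflexive y≡) x<v

∣X∣<2⇒≡ : (X : Subset n) → ∣ X ∣ ℕ.< 2 → ∀ {x y} → x ∈ X → y ∈ X → x ≡ y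
∣X∣<2⇒≡ X ∣X∣<2 {x} {y} x∈X y∈X with x ≟ y
... | yes x≡y = x≡y
... | no  x≢y = contradiction (ℕ.<-≤-trans (x∈p⇒∣p-x∣<∣p∣ y∈X) (ℕ.≤-pred ∣X∣<2))
  (nonempty (rank (x∈p∧x≢y⇒x∈p-y x∈X x≢y)))
  where
  nonempty : ∀ {k} → Fin k → ¬ k ℕ.< 1
  nonempty {suc _} _ (s≤s ())

-- A walk of ±1 steps that never revisits a point never turns round.
persist : {A : Set} {R : Rel A 0ℓ} → (∀ {x y z} → R x y → R z y → x ≡ z) →
  ∀ k (c : Fin (2 ℕ.+ k) → A) → Injective _≡_ _≡_ c →
  (∀ i → R (c (inject₁ i)) (c (suc i)) ⊎ R (c (suc i)) (c (inject₁ i))) →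
  R (c zero) (c (suc zero)) → ∀ i → R (c (inject₁ i)) (c (suc i))
persist R-inj k       c c-inj step first zero    = first
persist {R = R} R-inj (suc k) c c-inj step first (suc i) with step (suc zero)
... | inj₁ second =
  persist {R = R} R-inj k (c ∘ suc) (Fin.suc-injective ∘ c-inj) (step ∘ suc) second i
... | inj₂ back   with () ← c-inj (R-inj first back)

ascend : ∀ k (c : Fin (suc k) → ℕ) → (∀ i → c (suc i) ≡ suc (c (inject₁ i))) →
  c (fromℕ k) ≡ k ℕ.+ c zero
ascend zero    c step = refl
ascend (suc k) c step = trans (ascend k (c ∘ suc) (step ∘ suc))
  (trans (cong (k ℕ.+_) (step zero)) (ℕ.+-suc k _))

descend : ∀ k (c : Fin (suc k) → ℕ) → (∀ i → c (inject₁ i) ≡ suc (c (suc i))) →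
  c zero ≡ k ℕ.+ c (fromℕ k)
descend zero    c step = refl
descend (suc k) c step = trans (step zero) (cong suc (descend k (c ∘ suc) (step ∘ suc)))

-- For the closing edge of a supposed cycle on `3 + k` vertices of a path: after monotone steps its
-- ends are `2 + k` positions apart.
not-neighbours : ∀ {a b} k → a ≡ 2 ℕ.+ k ℕ.+ b → ¬ (b ≡ suc a ⊎ a ≡ suc b)
not-neighbours {b = b} k refl (inj₁ eq) = ℕ.m≢1+n+m b eq
not-neighbours {b = b} k refl (inj₂ eq) = ℕ.m≢1+n+m b (sym (ℕ.suc-injective eq))

foldr-⊔-upper : ∀ {r} (f : Fin r → ℕ) i → f i ℕ.≤ Vector.foldr _⊔_ 0 f
foldr-⊔-upper f zero    = ℕ.m≤m⊔n _ _
foldr-⊔-upper f (suc i) = ℕ.≤-trans (foldr-⊔-upper (f ∘ suc) i) (ℕ.m≤n⊔m _ _)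

foldr-⊔-least : ∀ {r} (f : Fin r → ℕ) → (∀ i → f i ℕ.≤ m) → Vector.foldr _⊔_ 0 f ℕ.≤ m
foldr-⊔-least {r = zero}  f f≤m = z≤n
foldr-⊔-least {r = suc r} f f≤m = ℕ.⊔-lub (f≤m zero) (foldr-⊔-least (f ∘ suc) (f≤m ∘ suc))

-- Graphs with a Hamiltonian cycle: 2-connectedness and the Hamiltonian path.

module Hamiltonian {N : ℕ} (G : Graph (suc N)) (2≤N : 2 ℕ.≤ N)
  (consecutive : ∀ {x y} → toℕ y ≡ suc (toℕ x) → ∃[ e ] Graph.ends G e ≡ (x , y))
  (closing : ∃[ e ] Graph.ends G e ≡ (zero , fromℕ N)) where

  open Graph G

  2-connected : VertexConnected G 2
  2-connected = s≤s 2≤N , connected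
    where
    avoiding-sym : ∀ {X} → Symmetric (AdjacentAvoiding G X)
    avoiding-sym (u∉ , v∉ , e , e∈ , joins) = v∉ , u∉ , e , e∈ , Sum.swap joins

    module _ (X : Subset (suc N)) (∣X∣<2 : ∣ X ∣ ℕ.< 2) where

      Avoids : Fin (suc N) → Fin (suc N) → Set
      Avoids u v = ∀ x → u Fin.≤ x → x Fin.≤ v → x ∉ X

      walk-avoiding : ∀ {u v} → u Fin.≤ v → Avoids u v → Star (AdjacentAvoiding G X) u v
      walk-avoiding {u} {v} u≤v avoids = walk u v u≤v λ x y u≤x y≡ y≤v →
        let x≤y = ℕ.≤-trans (ℕ.n≤1+n _) (ℕ.≤-reflexive (sym y≡))
            e , eq = consecutive y≡
        in avoids x u≤x (ℕ.≤-trans x≤y y≤v) , avoids y (ℕ.≤-trans u≤x x≤y) y≤v ,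
           e , ∈⊤ , inj₁ eq

      connected-< : ∀ {u v} → u Fin.< v → u ∉ X → v ∉ X → Star (AdjacentAvoiding G X) u v
      connected-< {u} {v} u<v u∉X v∉X
        with any? (λ x → (u Fin.<? x) ×-dec (x Fin.<? v) ×-dec (x ∈? X))
      ... | no ∄ = walk-avoiding (ℕ.<⇒≤ u<v) avoids
        where
        avoids : Avoids u v
        avoids x u≤x x≤v x∈X = ∄ (x ,
          ℕ.≤∧≢⇒< u≤x (λ eq → u∉X (subst (_∈ X) (sym (toℕ-injective eq)) x∈X)) ,
          ℕ.≤∧≢⇒< x≤v (λ eq → v∉X (subst (_∈ X) (toℕ-injective eq) x∈X)) , x∈X)
      ... | yes (c , u<c , c<v , c∈X) =
        -- The deleted vertex `c` lies strictly between `u` and `v`, so the walk goes the other way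
        -- round: down to `zero`, over the closing edge, and down to `v`.
        Star.reverse avoiding-sym (walk-avoiding z≤n below) ◅◅
        (below zero z≤n z≤n , above (fromℕ N) (Fin.≤fromℕ v) ℕ.≤-refl ,
          proj₁ closing , ∈⊤ , inj₁ (proj₂ closing)) ◅
        Star.reverse avoiding-sym (walk-avoiding (Fin.≤fromℕ v) above)
        where
        below : Avoids zero u
        below x _ x≤u x∈X = Fin.<⇒≢ (ℕ.≤-<-trans x≤u u<c) (∣X∣<2⇒≡ X ∣X∣<2 x∈X c∈X)
        above : Avoids v (fromℕ N)
        above x v≤x _ x∈X = Fin.<⇒≢ (ℕ.<-≤-trans c<v v≤x) (∣X∣<2⇒≡ X ∣X∣<2 c∈X x∈X)

      connected : ∀ {u v} → u ∉ X → v ∉ X → Star (AdjacentAvoiding G X) u v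
      connected {u} {v} u∉X v∉X with Fin.<-cmp u v
      ... | tri< u<v _ _ = connected-< u<v u∉X v∉X
      ... | tri≈ _ refl _ = ε
      ... | tri> _ _ v<u = Star.reverse avoiding-sym (connected-< v<u v∉X u∉X)

  Successive : Pred (Fin (suc N) × Fin (suc N)) 0ℓ
  Successive (x , y) = toℕ y ≡ suc (toℕ x)

  consecutive? : Decidable (Successive ∘ ends)
  consecutive? e = toℕ (proj₂ (ends e)) ℕ.≟ suc (toℕ (proj₁ (ends e)))

  path : Subset size
  path = subset consecutive?

  consecutive∈path : ∀ {e x y} → toℕ y ≡ suc (toℕ x) → ends e ≡ (x , y) → e ∈ path
  consecutive∈path y≡ eq = ∈-subset⁺ consecutive? (subst Successive (sym eq) y≡)

  path-step : ∀ {u v} → Adjacent[ path ] u v → toℕ v ≡ suc (toℕ u) ⊎ toℕ u ≡ suc (toℕ v)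
  path-step (e , e∈ , inj₁ eq) = inj₁ (subst Successive eq (∈-subset⁻ consecutive? e∈))
  path-step (e , e∈ , inj₂ eq) = inj₂ (subst Successive eq (∈-subset⁻ consecutive? e∈))

  path-isSpanningTree : IsSpanningTree G path
  path-isSpanningTree = record { connected = connected ; acyclic = acyclic }
    where
    path-sym : Symmetric Adjacent[ path ]
    path-sym (e , e∈ , joins) = e , e∈ , Sum.swap joins

    connected-≤ : ∀ u v → u Fin.≤ v → Star Adjacent[ path ] u v
    connected-≤ u v u≤v = walk u v u≤v λ x y _ y≡ _ → let e , eq = consecutive y≡ in
      e , consecutive∈path y≡ eq , inj₁ eq

    connected : ∀ u v → Star Adjacent[ path ] u v
    connected u v with Fin.≤-total u v
    ... | inj₁ u≤v = connected-≤ u v u≤v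
    ... | inj₂ v≤u = Star.reverse path-sym (connected-≤ v u v≤u)

    acyclic : ¬ Cycle Adjacent[ path ]
    acyclic record { k = k ; vertex = c ; injective = c-injective ; step = step ; close = close }
      -- By `persist` the first step decides the direction of all others, so positions along the
      -- cycle change monotonically and its ends cannot be neighbours.
      with path-step (step zero)
    ... | inj₁ up = not-neighbours k (ascend (2 ℕ.+ k) (toℕ ∘ c) λ i →
        persist {R = λ x y → toℕ y ≡ suc (toℕ x)}
          (λ p q → toℕ-injective (ℕ.suc-injective (trans (sym p) q)))
          (suc k) c c-injective (path-step ∘ step) up i)
        (path-step close)
    ... | inj₂ down = not-neighbours k (descend (2 ℕ.+ k) (toℕ ∘ c) λ i →
        persist {R = λ x y → toℕ x ≡ suc (toℕ y)}
          (λ p q → toℕ-injective (trans p (sym q)))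
          (suc k) c c-injective (Sum.swap ∘ path-step ∘ step) down i)
        (Sum.swap (path-step close))

  -- Pigeonhole on the `N` edges of the Hamiltonian path; this is the source of the lower bound on
  -- the discrepancy of every colouring.
  n∸1≤r*maxColour : ∀ {r} (f : Colouring G r) → N ℕ.≤ r ℕ.* maxColour G f path
  n∸1≤r*maxColour f = covering⇒≤ (λ i → colourClass G f i ∩ path)
    (foldr-⊔-upper (λ i → ∣ colourClass G f i ∩ path ∣))
    (proj₁ ∘ edge) edge-injective (f ∘ proj₁ ∘ edge)
    λ j → x∈p∩q⁺ (∈-subset⁺ (λ e → f e ≟ f (proj₁ (edge j))) refl ,
                  consecutive∈path (next j) (proj₂ (edge j)))
    where
    next : ∀ (j : Fin N) → toℕ (suc j) ≡ suc (toℕ (inject₁ j))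
    next j = cong suc (sym (Fin.toℕ-inject₁ j))

    edge : ∀ (j : Fin N) → ∃[ e ] ends e ≡ (inject₁ j , suc j)
    edge j = consecutive (next j)

    edge-injective : Injective _≡_ _≡_ (proj₁ ∘ edge)
    edge-injective {i} {j} eq = Fin.suc-injective
      (cong proj₂ (trans (sym (proj₂ (edge i))) (trans (cong ends eq) (proj₂ (edge j)))))

-- Existence of the separation number.

module _ (G : Graph n) where
  open Graph G

  private module _ (r : ℕ) where

    Fibres : Set
    Fibres = Maybe (Fin r) → Subset n

    fibres : (Fin n → Maybe (Fin r)) → Fibres
    fibres part x = subset (λ v → Maybe.≡-dec _≟_ (part v) x)

    Balanced Separated : Fibres → Set
    Balanced F  = ∀ i j → ∣ F (just i) ∣ ≡ ∣ F (just j) ∣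
    Separated F = ∀ i j → i ≢ j → ∀ u v → u ∈ F (just i) → v ∈ F (just j) → ¬ Adjacent u v

    adjacent? : ∀ u v → Dec (Adjacent u v)
    adjacent? u v = any? λ e → (e ∈? ⊤) ×-dec
      ((ends e ≟² (u , v)) ⊎-dec (ends e ≟² (v , u)))
      where
      _≟²_ : ∀ (p q : Fin n × Fin n) → Dec (p ≡ q)
      _≟²_ = ≡-dec _≟_ _≟_

    Separates : ℕ → Fibres → Set
    Separates s F = Balanced F × Separated F × ∣ F nothing ∣ ≡ s

    separates? : ∀ s F → Dec (Separates s F)
    separates? s F =
      (all? λ i → all? λ j → ∣ F (just i) ∣ ℕ.≟ ∣ F (just j) ∣) ×-dec
      (all? λ i → all? λ j → ¬? (i ≟ j) →-dec all? λ u → all? λ v →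
        (u ∈? F (just i)) →-dec (v ∈? F (just j)) →-dec ¬? (adjacent? u v)) ×-dec
      (∣ F nothing ∣ ℕ.≟ s)

    -- Needed because a labelling that has been encoded and decoded agrees with the original one
    -- only pointwise.
    Separates-resp : ∀ {s F F′} → (∀ x → F x ≡ F′ x) → Separates s F → Separates s F′
    Separates-resp F≡ (b , p , s) =
      (λ i j → trans (cong ∣_∣ (sym (F≡ (just i)))) (trans (b i j) (cong ∣_∣ (F≡ (just j))))) ,
      (λ i j i≢j u v u∈ v∈ →
        p i j i≢j u v (subst (u ∈_) (sym (F≡ _)) u∈) (subst (v ∈_) (sym (F≡ _)) v∈)) ,
      trans (cong ∣_∣ (sym (F≡ nothing))) s

    decode : Fin (suc r) → Maybe (Fin r)
    decode zero    = nothing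
    decode (suc i) = just i

    encode : Maybe (Fin r) → Fin (suc r)
    encode nothing  = zero
    encode (just i) = suc i

    decode-encode : ∀ x → decode (encode x) ≡ x
    decode-encode nothing  = refl
    decode-encode (just i) = refl

    -- Exhaustive search: labellings by `Maybe (Fin r)` are coded as numbers below `suc r ^ n`.
    separation? : ∀ s → Dec (∃[ P ] ∣ BalancedSeparation.S {G = G} {r} P ∣ ≡ s)
    separation? s = map′
      (λ (c , b , p , eq) → record { part = decode ∘ Fin.finToFun c ; balanced = b
                                   ; separated = λ i≢j → p _ _ i≢j _ _ } , eq)
      (λ (P , eq) → let open BalancedSeparation P in
        Fin.funToFin (encode ∘ part) ,
        Separates-resp (λ x → tabulate-cong λ v → cong (λ y → does (Maybe.≡-dec _≟_ y x))
            (sym (trans (cong decode (Fin.finToFun-funToFin (encode ∘ part) v))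
              (decode-encode (part v)))))
          (balanced , (λ i j i≢j u v → separated i≢j) , eq))
      (any? λ (c : Fin (suc r ℕ.^ n)) → separates? s (fibres (decode ∘ Fin.finToFun c)))

    -- The witness that bounds the search for the least size of `S`.
    everything : BalancedSeparation G r
    everything = record
      { part      = λ _ → nothing
      ; balanced  = λ _ _ → refl
      ; separated = λ {i} _ u∈ →
          contradiction (∈-subset⁻ (λ _ → Maybe.≡-dec _≟_ nothing (just i)) u∈) λ () }

  separationNumber-≥ : ∀ {q} r →
    (∀ (P : BalancedSeparation G r) → q ℕ.≤ ∣ BalancedSeparation.S P ∣) →
    ∃[ s ] IsSeparationNumber G r s × q ℕ.≤ s
  separationNumber-≥ r q≤∣S∣ with least (separation? r) _ (everything r , refl)
  ... | s , (P , refl) , min = s , ((P , refl) , min) , q≤∣S∣ P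

-- The graph of clique blocks on a cycle, and its vertex colouring.

module Construction (ρ K u : ℕ) (2≤K : 2 ℕ.≤ K)
  (blocks≡ : suc (suc (suc ρ) ℕ.* u) ≡ suc ρ ℕ.* K) where

  -- `N` is written so that `suc N` unfolds to `T * q`, which lets a vertex be split into block and
  -- offset without a cast. The parameter `ρ` is `r` minus 2.
  r T q N : ℕ
  r = suc (suc ρ)
  T = suc (r ℕ.* u)
  q = suc K
  N = K ℕ.+ r ℕ.* u ℕ.* q

  block : Fin (suc N) → Fin T
  block = Fin.quotient {T} q

  offset : Fin (suc N) → Fin q
  offset = Fin.remainder {T} q

  combine-split : ∀ x → combine (block x) (offset x) ≡ x
  combine-split = Fin.combine-remQuot {T} q

  block-combine : ∀ b j → block (combine b j) ≡ b
  block-combine b j = cong proj₁ (Fin.remQuot-combine {T} {q} b j)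

  Edge : Pred (Fin (suc N) × Fin (suc N)) 0ℓ
  Edge (x , y) = x Fin.< y ×
    (block x ≡ block y ⊎ toℕ y ≡ suc (toℕ x) ⊎ (x ≡ zero × y ≡ fromℕ N))

  edge? : Decidable Edge
  edge? (x , y) = (x Fin.<? y) ×-dec ((block x ≟ block y) ⊎-dec
    (toℕ y ℕ.≟ suc (toℕ x)) ⊎-dec ((x ≟ zero) ×-dec (y ≟ fromℕ N)))

  open FromRelation edge? proj₁
  open Graph graph
  open Forests graph

  0<N : 0 ℕ.< N
  0<N = ℕ.≤-trans (ℕ.≤-trans (s≤s z≤n) 2≤K) (ℕ.m≤m+n K _)

  open Hamiltonian graph (ℕ.≤-trans 2≤K (ℕ.m≤m+n K _))
    (λ y≡ → edge (ℕ.≤-reflexive (sym y≡) , inj₂ (inj₁ y≡)))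
    (edge (subst (0 ℕ.<_) (sym (Fin.toℕ-fromℕ N)) 0<N , inj₂ (inj₂ (refl , refl))))
    public

  -- A colour, one of 1 + u layers, and a place in it.  The non-first vertices of
  -- block r d + c take layer d of colour c; as T = r u + 1, this leaves the top
  -- layers of the colours suc c free for the first vertices.
  Slot : Set
  Slot = Fin r × Fin (suc u) × Fin K

  T≤ : T ℕ.≤ suc u ℕ.* r
  T≤ = subst (T ℕ.≤_) (trans (sym (ℕ.*-suc r u)) (ℕ.*-comm r (suc u)))
    (s≤s (ℕ.m≤n+m (r ℕ.* u) (suc ρ)))

  layer : Fin T → Fin (suc u) × Fin r
  layer b = Fin.remQuot {suc u} r (inject≤ b T≤)

  toℕ-layer : ∀ b → r ℕ.* toℕ (proj₁ (layer b)) ℕ.+ toℕ (proj₂ (layer b)) ≡ toℕ b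
  toℕ-layer b = trans (sym (Fin.toℕ-combine (proj₁ (layer b)) (proj₂ (layer b))))
    (trans (cong toℕ (Fin.combine-remQuot {suc u} r (inject≤ b T≤))) (toℕ-inject≤ b T≤))

  layer-injective : Injective _≡_ _≡_ layer
  layer-injective {b} {b′} eq = toℕ-injective (trans (sym (toℕ-layer b))
    (trans (cong (λ (d , c) → r ℕ.* toℕ d ℕ.+ toℕ c) eq) (toℕ-layer b′)))

  -- Layer `u` begins with block `r * u`, which is the last block, so only colour `zero` occurs
  -- there.
  top-layer : ∀ b c → layer b ≢ (fromℕ u , suc c)
  top-layer b c eq = ℕ.<⇒≱ (Fin.toℕ<n b) (subst (T ℕ.≤_)
    (trans (cong (λ (d , c) → r ℕ.* toℕ d ℕ.+ toℕ c) (sym eq)) (toℕ-layer b))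
    (ℕ.≤-trans (ℕ.+-monoʳ-≤ 1 (ℕ.m≤m+n (r ℕ.* u) (toℕ c)))
      (ℕ.≤-reflexive (trans (sym (ℕ.+-suc (r ℕ.* u) (toℕ c)))
        (cong (λ d → r ℕ.* d ℕ.+ suc (toℕ c)) (sym (Fin.toℕ-fromℕ u)))))))

  -- By `blocks≡` there are as many first vertices as places in the free top layers of the `suc ρ`
  -- nonzero colours.
  spread : Fin T → Fin (suc ρ) × Fin K
  spread b = Fin.remQuot {suc ρ} K (Fin.cast blocks≡ b)

  spread-injective : Injective _≡_ _≡_ spread
  spread-injective {b} {b′} eq = toℕ-injective (trans (sym (Fin.toℕ-cast blocks≡ b))
    (trans (cong toℕ (trans (sym (Fin.combine-remQuot {suc ρ} K _))
      (trans (cong (λ (c , j) → combine c j) eq) (Fin.combine-remQuot {suc ρ} K _))))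
      (Fin.toℕ-cast blocks≡ b′)))

  slotAt : Fin T → Fin q → Slot
  slotAt b zero    = suc (proj₁ (spread b)) , fromℕ u , proj₂ (spread b)
  slotAt b (suc j) = proj₂ (layer b) , proj₁ (layer b) , j

  slotAt-injective : ∀ b j b′ j′ → slotAt b j ≡ slotAt b′ j′ → combine b j ≡ combine b′ j′
  slotAt-injective b zero b′ zero eq = cong (λ b → combine b zero) (spread-injective {b} {b′}
    (cong₂ _,_ (Fin.suc-injective (cong proj₁ eq)) (cong (proj₂ ∘ proj₂) eq)))
  slotAt-injective b zero b′ (suc j′) eq = contradiction
    (sym (cong₂ _,_ (cong (proj₁ ∘ proj₂) eq) (cong proj₁ eq))) (top-layer b′ _)
  slotAt-injective b (suc j) b′ zero eq = contradiction
    (cong₂ _,_ (cong (proj₁ ∘ proj₂) eq) (cong proj₁ eq)) (top-layer b _)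
  slotAt-injective b (suc j) b′ (suc j′) eq = cong₂ combine
    (layer-injective {b} {b′} (cong₂ _,_ (cong (proj₁ ∘ proj₂) eq) (cong proj₁ eq)))
    (cong (suc ∘ proj₂ ∘ proj₂) eq)

  slot : Fin (suc N) → Slot
  slot x = slotAt (block x) (offset x)

  slot-injective : Injective _≡_ _≡_ slot
  slot-injective {x} {y} eq = trans (sym (combine-split x))
    (trans (slotAt-injective (block x) (offset x) (block y) (offset y) eq) (combine-split y))

  κ : Fin (suc N) → Fin r
  κ = proj₁ ∘ slot

  κ-block : ∀ {x y} → block x ≡ block y → offset x ≢ zero → offset y ≢ zero → κ x ≡ κ y
  κ-block {x} {y} eq x≢0 y≢0 with offset x | offset y
  ... | zero  | _     = contradiction refl x≢0
  ... | suc _ | zero  = contradiction refl y≢0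
  ... | suc _ | suc _ = cong (proj₂ ∘ layer) eq

  -- The edge colouring and its classes inside a forest.

  SameBlock : Pred (Fin size) 0ℓ
  SameBlock e = block (proj₁ (ends e)) ≡ block (proj₂ (ends e))

  sameBlock? : Decidable SameBlock
  sameBlock? e = block (proj₁ (ends e)) ≟ block (proj₂ (ends e))

  data Kind (e : Fin size) : Set where
    within   : SameBlock e → Kind e
    entering : ¬ SameBlock e → toℕ (proj₂ (ends e)) ≡ suc (toℕ (proj₁ (ends e))) → Kind e
    closing  : ends e ≡ (zero , fromℕ N) → Kind e

  classify : ∀ {e} → Dec (SameBlock e) → Edge (ends e) → Kind e
  classify (yes same) _                                = within same
  classify (no ¬same) (_ , inj₁ same)                  = within same
  classify (no ¬same) (_ , inj₂ (inj₁ y≡))             = entering ¬same y≡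
  classify (no ¬same) (_ , inj₂ (inj₂ (x≡0 , y≡last))) = closing (cong₂ _,_ x≡0 y≡last)

  kind : ∀ e → Kind e
  kind e = classify (sameBlock? e) (related e)

  -- The vertex whose colour the edge receives. Within a block it is the upper end, which is never
  -- the first vertex. The closing edge gets `zero`, the one first vertex that no entering edge
  -- reaches.
  head : ∀ {e} → Kind e → Fin (suc N)
  head {e} (within _)     = proj₂ (ends e)
  head {e} (entering _ _) = proj₂ (ends e)
  head     (closing _)    = zero

  colouring : Colouring graph r
  colouring e = κ (head (kind e))

  upper-offset : ∀ {x y} → x Fin.< y → block x ≡ block y → offset y ≢ zero
  upper-offset {x} {y} x<y bx≡by y≡0 = ℕ.<⇒≱ x<y (begin
    toℕ y                                     ≡⟨ toℕ-split y ⟩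
    q ℕ.* toℕ (block y) ℕ.+ toℕ (offset y)    ≡⟨ cong₂ (λ b j → q ℕ.* toℕ b ℕ.+ toℕ j) (sym bx≡by) y≡0 ⟩
    q ℕ.* toℕ (block x) ℕ.+ 0                 ≤⟨ ℕ.+-monoʳ-≤ (q ℕ.* toℕ (block x)) z≤n ⟩
    q ℕ.* toℕ (block x) ℕ.+ toℕ (offset x)    ≡⟨ toℕ-split x ⟨
    toℕ x                                     ∎)
    where
    open ℕ.≤-Reasoning
    toℕ-split : ∀ x → toℕ x ≡ q ℕ.* toℕ (block x) ℕ.+ toℕ (offset x)
    toℕ-split x = trans (cong toℕ (sym (combine-split x))) (Fin.toℕ-combine (block x) (offset x))

  -- At a positive offset the predecessor of `y` would lie in the block of `y`.
  entering-offset : ∀ {x y} → toℕ y ≡ suc (toℕ x) → block x ≢ block y → offset y ≡ zero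
  entering-offset {x} {y} y≡ bx≢by with offset y | combine-split y
  ... | zero  | _ = refl
  ... | suc j | y-split = contradiction
    (trans (cong block (sym pred-y)) (block-combine (block y) (inject₁ j))) bx≢by
    where
    open ≡-Reasoning
    pred-y : combine (block y) (inject₁ j) ≡ x
    pred-y = toℕ-injective (ℕ.suc-injective (begin
      suc (toℕ (combine (block y) (inject₁ j)))          ≡⟨ cong suc (Fin.toℕ-combine (block y) (inject₁ j)) ⟩
      suc (q ℕ.* toℕ (block y) ℕ.+ toℕ (inject₁ j))      ≡⟨ cong (λ i → suc (q ℕ.* toℕ (block y) ℕ.+ i))
                                                               (Fin.toℕ-inject₁ j) ⟩
      suc (q ℕ.* toℕ (block y) ℕ.+ toℕ j)                ≡⟨ ℕ.+-suc _ _ ⟨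
      q ℕ.* toℕ (block y) ℕ.+ toℕ (suc j)                ≡⟨ Fin.toℕ-combine (block y) (suc j) ⟨
      toℕ (combine (block y) (suc j))                    ≡⟨ cong toℕ y-split ⟩
      toℕ y                                              ≡⟨ y≡ ⟩
      suc (toℕ x)                                        ∎))

  module _ (F : Subset size) (acyclic : ¬ Cycle Adjacent[ F ]) where

    -- Serves as the map `ρ` of `UnionFind`: its fixed points are the first vertices of blocks, so
    -- every child is a non-first vertex of the block of its edge.
    base : Fin (suc N) → Fin (suc N)
    base x = combine (block x) zero

    inner? : Decidable (λ e → e ∈ F × SameBlock e)
    inner? e = (e ∈? F) ×-dec sameBlock? e

    inner : List (Fin size)
    inner = filter inner? (allFin size)

    inner-forest : UnionFind base inner
    inner-forest = unionFind base (Unique.filter⁺ inner? (Unique.allFin⁺ size))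
      (acyclic ∘ Cycle-map λ (e , e∈ , joins) →
        e , proj₁ (proj₂ (∈-filter⁻ inner? {xs = allFin size} e∈)) , joins)
      (All.map (cong (λ b → combine b zero) ∘ proj₂) (all-filter inner? (allFin size)))

    open UnionFind inner-forest

    -- Several edges within a block can share a head, so these are charged to their children
    -- instead. The colour stays the same, as it is constant on the non-first vertices of a block.
    mark : ∀ {e} → Kind e → Fin (suc N)
    mark {e} (within _)         = child e
    mark k@(entering _ _)       = head k
    mark k@(closing _)          = head k

    ∈-inner : ∀ {e} → e ∈ F → SameBlock e → e ∈ˡ inner
    ∈-inner e∈F same = ∈-filter⁺ inner? (∈-allFin _) (e∈F , same)

    child-offset : ∀ {e} → e ∈ˡ inner → offset (child e) ≢ zero
    child-offset {e} e∈ eq = child-moved e∈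
      (trans (cong (combine (block (child e))) (sym eq)) (combine-split (child e)))

    child-block : ∀ {e} → e ∈ˡ inner → block (child e) ≡ block (proj₁ (ends e))
    child-block {e} e∈ = Fin.combine-injectiveˡ _ _ _ _ (ρ-child e∈)

    κ-mark : ∀ {e} (k : Kind e) → e ∈ F → κ (mark k) ≡ κ (head k)
    κ-mark {e} (within same) e∈F = κ-block {child e} {proj₂ (ends e)}
      (trans (child-block e∈) same) (child-offset e∈)
      (upper-offset (ends-ordered e) same)
      where e∈ = ∈-inner e∈F same
    κ-mark (entering _ _) _ = refl
    κ-mark (closing _)    _ = refl

    mark-injective : ∀ {e e′} (k : Kind e) (k′ : Kind e′) → e ∈ F → e′ ∈ F →
      mark k ≡ mark k′ → e ≡ e′
    mark-injective (within s) (within s′) e∈ e′∈ eq =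
      child-injective (∈-inner e∈ s) (∈-inner e′∈ s′) eq
    mark-injective (within s) (entering ¬s′ y≡) e∈ _ eq =
      contradiction (trans (cong offset eq) (entering-offset y≡ ¬s′)) (child-offset (∈-inner e∈ s))
    mark-injective (within s) (closing _) e∈ _ eq =
      contradiction (cong offset eq) (child-offset (∈-inner e∈ s))
    mark-injective (entering ¬s y≡) (within s′) _ e′∈ eq =
      contradiction (trans (cong offset (sym eq)) (entering-offset y≡ ¬s)) (child-offset (∈-inner e′∈ s′))
    mark-injective (entering _ y≡) (entering _ y′≡) _ _ eq = ends-injective (cong₂ _,_
      (toℕ-injective (ℕ.suc-injective (trans (sym y≡) (trans (cong toℕ eq) y′≡)))) eq)
    mark-injective (entering _ y≡) (closing _) _ _ eq =
      contradiction (trans (sym (cong toℕ eq)) y≡) ℕ.0≢1+n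
    mark-injective (closing _) (within s′) _ e′∈ eq =
      contradiction (cong offset (sym eq)) (child-offset (∈-inner e′∈ s′))
    mark-injective (closing _) (entering _ y≡) _ _ eq =
      contradiction (trans (cong toℕ eq) y≡) ℕ.0≢1+n
    mark-injective (closing p) (closing p′) _ _ _ = ends-injective (trans p (sym p′))

    -- The marks of these edges are distinct and all have colour `i`, so they occupy distinct places
    -- in the `suc u` layers of that colour.
    colourClass-bound : ∀ i → ∣ colourClass graph colouring i ∩ F ∣ ℕ.≤ suc u ℕ.* K
    colourClass-bound i = ∣p∣≤ _ (λ {e} _ → uncurry combine (proj₂ (slot (mark (kind e)))))
      λ {e} {e′} e∈ e′∈ eq →
        let c≡i  , e∈F  = split e∈
            c′≡i , e′∈F = split e′∈
            d≡ , j≡ = combine-injective _ _ _ _ eq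
        in mark-injective (kind e) (kind e′) e∈F e′∈F (slot-injective (cong₂ _,_
          (trans (κ-mark (kind e) e∈F) (trans c≡i (sym (trans (κ-mark (kind e′) e′∈F) c′≡i))))
          (cong₂ _,_ d≡ j≡)))
      where
      split : ∀ {e} → e ∈ colourClass graph colouring i ∩ F → colouring e ≡ i × e ∈ F
      split e∈ with e∈C , e∈F ← x∈p∩q⁻ _ F e∈ = ∈-subset⁻ (λ e → colouring e ≟ i) e∈C , e∈F

  -- Lower bound on the separator.

  q≤∣S∣ : (P : BalancedSeparation graph r) → q ℕ.≤ ∣ BalancedSeparation.S P ∣
  q≤∣S∣ P = bound
    where
    open BalancedSeparation P

    meets? : ∀ i → Decidable (λ b → ∃[ j ] combine b j ∈ V i)
    meets? i b = any? λ j → combine b j ∈? V i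

    meets : Fin r → Subset T
    meets i = subset (meets? i)

    part-V : ∀ {i x} → x ∈ V i → part x ≡ just i
    part-V {i} = ∈-subset⁻ (λ v → Maybe.≡-dec _≟_ (part v) (just i))

    ∈-V : ∀ {i x} → part x ≡ just i → x ∈ V i
    ∈-V {i} = ∈-subset⁺ (λ v → Maybe.≡-dec _≟_ (part v) (just i))

    block∈meets : ∀ {i x} → x ∈ V i → block x ∈ meets i
    block∈meets {i} {x} x∈ = ∈-subset⁺ (meets? i) (offset x , subst (_∈ V i) (sym (combine-split x)) x∈)

    -- Blocks are cliques: two vertices of one block are equal or adjacent, and neither is possible
    -- across different parts.
    no-adjacent : ∀ {i j x y} → i ≢ j → x ∈ V i → y ∈ V j → block x ≢ block y
    no-adjacent {x = x} {y} i≢j x∈ y∈ eq with Fin.<-cmp x y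
    ... | tri< x<y _ _ = let e , ends≡ = edge (x<y , inj₁ eq) in
      separated i≢j x∈ y∈ (e , ∈⊤ , inj₁ ends≡)
    ... | tri≈ _ refl _ = i≢j (Maybe.just-injective (trans (sym (part-V x∈)) (part-V y∈)))
    ... | tri> _ _ y<x = let e , ends≡ = edge (y<x , inj₁ (sym eq)) in
      separated i≢j x∈ y∈ (e , ∈⊤ , inj₂ ends≡)

    meets-disjoint : ∀ {i j b} → b ∈ meets i → b ∈ meets j → i ≡ j
    meets-disjoint {i} {j} {b} b∈i b∈j with i ≟ j | ∈-subset⁻ (meets? i) b∈i | ∈-subset⁻ (meets? j) b∈j
    ... | yes i≡j | _ | _ = i≡j
    ... | no  i≢j | k , x∈ | l , y∈ = contradiction
      (trans (block-combine b k) (sym (block-combine b l))) (no-adjacent i≢j x∈ y∈)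

    ∣V∣≤ : ∀ i → ∣ V i ∣ ℕ.≤ ∣ meets i ∣ ℕ.* q
    ∣V∣≤ i = ∣p∣≤ (V i) (λ {x} x∈ → combine (rank (block∈meets x∈)) (offset x))
      λ {x} {y} x∈ y∈ eq →
        let b≡ , j≡ = combine-injective
              (rank (block∈meets x∈)) (offset x) (rank (block∈meets y∈)) (offset y) eq
        in trans (sym (combine-split x)) (trans
             (cong₂ combine (rank-injective (block∈meets x∈) (block∈meets y∈) b≡) j≡)
             (combine-split y))

    label : ∀ {x} → x ∉ S → ∃[ i ] part x ≡ just i
    label {x} x∉S with part x in eq
    ... | just i  = i , refl
    ... | nothing = contradiction (∈-subset⁺ (λ v → Maybe.≡-dec _≟_ (part v) nothing) eq) x∉S

    bound : q ℕ.≤ ∣ S ∣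
    bound with any? (λ i → ∣ meets i ∣ ℕ.≤? u)
    -- The parts would meet disjoint sets of at least `suc u` blocks each, in total `r * suc u`
    -- blocks, which exceeds `T`.
    ... | no ∄ = contradiction
      (disjoint⇒≤ {k = suc u} meets (λ i → ℕ.≰⇒> (λ le → ∄ (i , le)))
        (λ {i} {j} → meets-disjoint {i} {j}))
      (ℕ.<⇒≱ (subst (T ℕ.<_) (sym (ℕ.*-suc r u)) (s≤s (s≤s (ℕ.m≤n+m (r ℕ.* u) ρ)))))
    -- By balance every part is as small as `V i`, so at most `r * u * q` of the `q + r * u * q`
    -- vertices lie outside `S`.
    ... | yes (i , le) = ℕ.+-cancelʳ-≤ (r ℕ.* u ℕ.* q) q ∣ S ∣ (begin
        suc N                          ≤⟨ ℕ.m≤n+m∸n (suc N) ∣ S ∣ ⟩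
        ∣ S ∣ ℕ.+ (suc N ∸ ∣ S ∣)      ≡⟨ cong (∣ S ∣ ℕ.+_) (∣∁p∣≡n∸∣p∣ S) ⟨
        ∣ S ∣ ℕ.+ ∣ ∁ S ∣              ≤⟨ ℕ.+-monoʳ-≤ ∣ S ∣ outside≤ ⟩
        ∣ S ∣ ℕ.+ r ℕ.* (u ℕ.* q)      ≡⟨ cong (∣ S ∣ ℕ.+_) (ℕ.*-assoc r u q) ⟨
        ∣ S ∣ ℕ.+ r ℕ.* u ℕ.* q        ∎)
      where
      open ℕ.≤-Reasoning
      label′ : ∀ j → ∃[ i ] part (enumerate (∁ S) j) ≡ just i
      label′ j = label (x∈∁p⇒x∉p (enumerate-∈ (∁ S) j))

      outside≤ : ∣ ∁ S ∣ ℕ.≤ r ℕ.* (u ℕ.* q)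
      outside≤ = covering⇒≤ V
        (λ j → ℕ.≤-trans (ℕ.≤-reflexive (balanced j i)) (ℕ.≤-trans (∣V∣≤ i) (ℕ.*-monoˡ-≤ q le)))
        (enumerate (∁ S)) (enumerate-injective (∁ S)) (proj₁ ∘ label′) (∈-V ∘ proj₂ ∘ label′)

-- Rational arithmetic.

toℚᵘ-/ : ∀ k d .{{_ : NonZero d}} → toℚᵘ (+ k / d) ≃ (+ k ℚᵘ./ d)
toℚᵘ-/ k (suc d) = ℚ.toℚᵘ-fromℚᵘ (mkℚᵘ (+ k) d)

toℚ-mono-≤ : m ℕ.≤ n → toℚ m ℚ.≤ toℚ n
toℚ-mono-≤ {m} {n} m≤n = ℚ.toℚᵘ-cancel-≤ (begin
  toℚᵘ (toℚ m)   ≃⟨ toℚᵘ-/ m 1 ⟩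
  mkℚᵘ (+ m) 0   ≤⟨ *≤* (ℤ.*-monoʳ-≤-nonNeg (+ 1) (+≤+ m≤n)) ⟩
  mkℚᵘ (+ n) 0   ≃⟨ toℚᵘ-/ n 1 ⟨
  toℚᵘ (toℚ n)   ∎)
  where open ℚᵘ.≤-Reasoning

-- The factor `r` clears the denominator and leaves `r * M` minus `k`. Over unnormalised rationals
-- this becomes an integer identity.
discrepancy≡1 : ∀ r .{{_ : NonZero r}} M k → r ℕ.* M ≡ suc k →
  toℚ r ℚ.* (toℚ M ℚ.- + k / r) ≡ 1ℚ
discrepancy≡1 r@(suc r-1) M k r*M≡ = ℚ.toℚᵘ-injective (begin
  toℚᵘ (toℚ r ℚ.* (toℚ M ℚ.- + k / r))
    ≈⟨ ℚ.toℚᵘ-homo-* (toℚ r) _ ⟩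
  toℚᵘ (toℚ r) ℚᵘ.* toℚᵘ (toℚ M ℚ.- + k / r)
    ≈⟨ ℚᵘ.*-cong (toℚᵘ-/ r 1) (ℚ.toℚᵘ-homo-+ (toℚ M) _) ⟩
  mkℚᵘ (+ r) 0 ℚᵘ.* (toℚᵘ (toℚ M) ℚᵘ.+ toℚᵘ (ℚ.- (+ k / r)))
    ≈⟨ ℚᵘ.*-congˡ {mkℚᵘ (+ r) 0} (ℚᵘ.+-cong (toℚᵘ-/ M 1) neg) ⟩
  mkℚᵘ (+ r) 0 ℚᵘ.* (mkℚᵘ (+ M) 0 ℚᵘ.- mkℚᵘ (+ k) r-1)
    ≈⟨ *≡* cross ⟩
  ℚᵘ.1ℚᵘ
    ∎)
  where
  neg : toℚᵘ (ℚ.- (+ k / r)) ≃ ℚᵘ.- mkℚᵘ (+ k) r-1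
  neg = ℚᵘ.≃-trans (ℚ.toℚᵘ-homo‿- (+ k / r)) (ℚᵘ.-‿cong (toℚᵘ-/ k r))

  open import Relation.Binary.Reasoning.Setoid ℚᵘ.≃-setoid
  module E = ≡-Reasoning
  inner : + M ℤ.* + r ℤ.+ ℤ.- (+ k) ℤ.* + 1 ≡ + 1
  inner = E.begin
    + M ℤ.* + r ℤ.+ ℤ.- (+ k) ℤ.* + 1  E.≡⟨ cong₂ ℤ._+_
      (trans (sym (ℤ.pos-* M r)) (cong +_ (trans (ℕ.*-comm M r) r*M≡))) (ℤ.*-identityʳ (ℤ.- (+ k))) ⟩
    + suc k ℤ.- + k                    E.≡⟨ ℤ.m-n≡m⊖n (suc k) k ⟩
    suc k ℤ.⊖ k                        E.≡⟨ ℤ.⊖-≥ (ℕ.n≤1+n k) ⟩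
    + (suc k ∸ k)                      E.≡⟨ cong +_ (ℕ.m+n∸n≡m 1 k) ⟩
    + 1                                E.∎
  cross : + r ℤ.* (+ M ℤ.* + r ℤ.+ ℤ.- (+ k) ℤ.* + 1) ℤ.* + 1 ≡ + 1 ℤ.* + (1 ℕ.* (1 ℕ.* r))
  cross = E.begin
    + r ℤ.* (+ M ℤ.* + r ℤ.+ ℤ.- (+ k) ℤ.* + 1) ℤ.* + 1  E.≡⟨ ℤ.*-identityʳ _ ⟩
    + r ℤ.* (+ M ℤ.* + r ℤ.+ ℤ.- (+ k) ℤ.* + 1)          E.≡⟨ cong (+ r ℤ.*_) inner ⟩
    + r ℤ.* + 1                                          E.≡⟨ ℤ.*-identityʳ _ ⟩
    + r                                                  E.≡⟨ cong +_ (trans (ℕ.*-identityˡ (1 ℕ.* r)) (ℕ.*-identityˡ r)) ⟨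
    + (1 ℕ.* (1 ℕ.* r))                                  E.≡⟨ ℤ.*-identityˡ _ ⟨
    + 1 ℤ.* + (1 ℕ.* (1 ℕ.* r))                          E.∎

-- The hypothesis is the squared inequality after multiplication by `r * r`.
≥1/r√ : ∀ r .{{_ : NonZero r}} s n → n ℕ.≤ s ℕ.* s ℕ.* (r ℕ.* r) → s ≥ (+ 1 / r) √ n
≥1/r√ r@(suc r-1) s n n≤ = ℚ.toℚᵘ-cancel-≤ (begin
  toℚᵘ (+ 1 / r ℚ.* (+ 1 / r) ℚ.* toℚ n)
    ≃⟨ ℚ.toℚᵘ-homo-* (+ 1 / r ℚ.* (+ 1 / r)) (toℚ n) ⟩
  toℚᵘ (+ 1 / r ℚ.* (+ 1 / r)) ℚᵘ.* toℚᵘ (toℚ n)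
    ≃⟨ ℚᵘ.*-cong (ℚᵘ.≃-trans (ℚ.toℚᵘ-homo-* (+ 1 / r) (+ 1 / r))
         (ℚᵘ.*-cong (toℚᵘ-/ 1 r) (toℚᵘ-/ 1 r))) (toℚᵘ-/ n 1) ⟩
  mkℚᵘ (+ 1) r-1 ℚᵘ.* mkℚᵘ (+ 1) r-1 ℚᵘ.* mkℚᵘ (+ n) 0
    ≤⟨ *≤* (subst₂ ℤ._≤_ lhs rhs (+≤+ n≤)) ⟩
  mkℚᵘ (+ s) 0 ℚᵘ.* mkℚᵘ (+ s) 0
    ≃⟨ ℚᵘ.*-cong (toℚᵘ-/ s 1) (toℚᵘ-/ s 1) ⟨
  toℚᵘ (toℚ s) ℚᵘ.* toℚᵘ (toℚ s)
    ≃⟨ ℚ.toℚᵘ-homo-* (toℚ s) (toℚ s) ⟨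
  toℚᵘ (toℚ s ℚ.* toℚ s)
    ∎)
  where
  open ℚᵘ.≤-Reasoning
  lhs : + n ≡ + 1 ℤ.* + 1 ℤ.* + n ℤ.* + 1
  lhs = sym (trans (ℤ.*-identityʳ _) (ℤ.*-identityˡ (+ n)))
  rhs : + (s ℕ.* s ℕ.* (r ℕ.* r)) ≡ + s ℤ.* + s ℤ.* + (r ℕ.* r ℕ.* 1)
  rhs = trans (ℤ.pos-* (s ℕ.* s) (r ℕ.* r))
    (cong₂ ℤ._*_ (ℤ.pos-* s s) (cong +_ (sym (ℕ.*-identityʳ (r ℕ.* r)))))

-- The exact discrepancy and the choice of parameters.

module Discrepancy (ρ K u : ℕ) (2≤K : 2 ℕ.≤ K)
  (blocks≡ : suc (suc (suc ρ) ℕ.* u) ≡ suc ρ ℕ.* K) where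

  open Construction ρ K u 2≤K blocks≡
  open FromRelation edge? proj₁
  open Graph graph

  capacity : ℕ
  capacity = suc u ℕ.* K

  -- Since `r * suc u` is `T + suc ρ` and `suc ρ * K` is `T`, the product is `T * K + T`. The slots
  -- are thus exactly as many as the vertices.
  r*capacity≡n : r ℕ.* capacity ≡ suc N
  r*capacity≡n = begin
    r ℕ.* (suc u ℕ.* K)              ≡⟨ ℕ.*-assoc r (suc u) K ⟨
    r ℕ.* suc u ℕ.* K                ≡⟨ cong (ℕ._* K)
      (trans (ℕ.*-suc r u) (cong suc (ℕ.+-comm (suc ρ) (r ℕ.* u)))) ⟩
    (T ℕ.+ suc ρ) ℕ.* K              ≡⟨ ℕ.*-distribʳ-+ K T (suc ρ) ⟩
    T ℕ.* K ℕ.+ suc ρ ℕ.* K          ≡⟨ cong (T ℕ.* K ℕ.+_) blocks≡ ⟨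
    T ℕ.* K ℕ.+ T                    ≡⟨ ℕ.+-comm (T ℕ.* K) T ⟩
    T ℕ.+ T ℕ.* K                    ≡⟨ ℕ.*-suc T K ⟨
    T ℕ.* q                          ∎
    where open ≡-Reasoning

  discrepancyOf : ℕ → ℚ
  discrepancyOf M = toℚ r ℚ.* (toℚ M ℚ.- + N / r)

  discrepancyOf-mono : ∀ {M M′} → M ℕ.≤ M′ → discrepancyOf M ℚ.≤ discrepancyOf M′
  discrepancyOf-mono M≤M′ = ℚ.*-monoˡ-≤-nonNeg (toℚ r) {{ℚ.normalize-nonNeg r 1}}
    (ℚ.+-monoˡ-≤ (ℚ.- (+ N / r)) (toℚ-mono-≤ M≤M′))

  discrepancyOf-capacity : discrepancyOf capacity ≡ 1ℚ
  discrepancyOf-capacity = discrepancy≡1 r capacity N r*capacity≡n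

  -- By integrality: a smaller maximum would leave room for at most `suc N` minus `r` edges of the
  -- path, fewer than its `N` edges as `r` is at least 2.
  capacity≤ : (f : Colouring graph r) → capacity ℕ.≤ maxColour graph f path
  capacity≤ f = ℕ.≮⇒≥ λ M<c → ℕ.<⇒≱ (s≤s (s≤s z≤n)) (ℕ.+-cancelʳ-≤ N r 1 (begin
    r ℕ.+ N                            ≤⟨ ℕ.+-monoʳ-≤ r (n∸1≤r*maxColour f) ⟩
    r ℕ.+ r ℕ.* maxColour graph f path ≡⟨ ℕ.*-suc r _ ⟨
    r ℕ.* suc (maxColour graph f path) ≤⟨ ℕ.*-monoʳ-≤ r M<c ⟩
    r ℕ.* capacity                     ≡⟨ r*capacity≡n ⟩
    suc N                              ∎))
    where open ℕ.≤-Reasoning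

  maxColour≤ : ∀ {F} → IsSpanningTree graph F → maxColour graph colouring F ℕ.≤ capacity
  maxColour≤ {F} F-tree = foldr-⊔-least (λ i → ∣ colourClass graph colouring i ∩ F ∣)
    (colourClass-bound F (IsSpanningTree.acyclic F-tree))

  -- Every colouring reaches `capacity` on the Hamiltonian path, and `colouring` exceeds it on no
  -- spanning tree, so the value is exactly 1.
  discrepancy : IsSpanningTreeDiscrepancy graph r 1ℚ
  discrepancy =
    (colouring ,
      (path , path-isSpanningTree , trans (sym discrepancyOf-capacity)
        (cong discrepancyOf (ℕ.≤-antisym (capacity≤ colouring) (maxColour≤ path-isSpanningTree)))) ,
      λ { (F , F-tree , refl) → ℚ.≤-trans (discrepancyOf-mono (maxColour≤ F-tree))
            (ℚ.≤-reflexive discrepancyOf-capacity) }) ,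
    λ { (f , _ , upper) → ℚ.≤-trans (ℚ.≤-trans (ℚ.≤-reflexive (sym discrepancyOf-capacity))
          (discrepancyOf-mono (capacity≤ f))) (upper (path , path-isSpanningTree , refl)) }

  -- Already `r * s * s` is an upper bound; the further factor `r` makes it a perfect square, so
  -- that the constant can be the rational `1 / r`.
  n≤ : ∀ {s} → q ℕ.≤ s → suc N ℕ.≤ s ℕ.* s ℕ.* (r ℕ.* r)
  n≤ {s} q≤s = begin
    T ℕ.* q                       ≡⟨ cong (ℕ._* q) blocks≡ ⟩
    suc ρ ℕ.* K ℕ.* q             ≤⟨ ℕ.*-mono-≤
      (ℕ.*-mono-≤ (ℕ.n≤1+n (suc ρ)) (ℕ.≤-trans (ℕ.n≤1+n K) q≤s)) q≤s ⟩
    r ℕ.* s ℕ.* s                 ≡⟨ trans (ℕ.*-assoc r s s) (ℕ.*-comm r (s ℕ.* s)) ⟩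
    s ℕ.* s ℕ.* r                 ≤⟨ ℕ.*-monoʳ-≤ (s ℕ.* s) (ℕ.m≤m*n r r) ⟩
    s ℕ.* s ℕ.* (r ℕ.* r)         ∎
    where open ℕ.≤-Reasoning

  witness : ∃[ n ] K ℕ.≤ n × ∃[ G ]
    VertexConnected {n} G 2 ×
    (∃[ s ] IsSeparationNumber G r s × s ≥ (+ 1 / r) √ n) ×
    (∃[ d ] IsSpanningTreeDiscrepancy G r d × d ℚ.≤ 1ℚ)
  witness = suc N , ℕ.≤-trans (ℕ.m≤m+n K _) (ℕ.n≤1+n N) , graph , 2-connected ,
    (let s , isMinimum , q≤s = separationNumber-≥ graph r q≤∣S∣
     in s , isMinimum , ≥1/r√ r s (suc N) (n≤ q≤s)) ,
    (1ℚ , discrepancy , ℚ.≤-refl)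

proposition1p2 : (r : ℕ) .{{_ : NonZero r}} → 2 ℕ.≤ r →
    ∃[ c ] 0ℚ ℚ.< c ×
    (∀ (N : ℕ) → ∃[ n ] N ℕ.≤ n × ∃[ G ]
    VertexConnected {n} G 2 ×
    (∃[ s ] IsSeparationNumber G r s × s ≥ c √ n) ×
    (∃[ d ] IsSpanningTreeDiscrepancy G r d × d ℚ.≤ 1ℚ))
proposition1p2 r@(suc (suc ρ)) (s≤s (s≤s z≤n)) =
  + 1 / r , ℚ.positive⁻¹ (+ 1 / r) {{ℚ.normalize-pos 1 r}} , λ N →
  let n , K≤n , rest = witness ρ (K N) (u N) (ℕ.+-mono-≤ (s≤s z≤n) (s≤s z≤n)) (blocks≡ ρ N)
  in n , ℕ.≤-trans (ℕ.≤-trans (ℕ.n≤1+n N) (ℕ.m≤m+n (suc N) _)) K≤n , rest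
  where
  open Discrepancy using (witness)

  -- Both choices come from q = r * (2 + N).
  K u : ℕ → ℕ
  K N = suc N ℕ.+ suc ρ ℕ.* suc (suc N)
  u N = suc N ℕ.+ ρ ℕ.* suc (suc N)

  -- With m = 2 + N and q = r m this reads r ((r - 1) m - 1) + 1 = (r - 1) (r m - 1).
  blocks≡ : ∀ ρ N → suc (suc (suc ρ) ℕ.* (suc N ℕ.+ ρ ℕ.* suc (suc N))) ≡
    suc ρ ℕ.* (suc N ℕ.+ suc ρ ℕ.* suc (suc N))
  blocks≡ = solve-∀
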